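{- Let $G$ be a finite abelian group of order $n$ such that the generalized dihedral group $D(G)$ is non-abelian, let $r\ge0$ satisfy $2^r=|\{g\in G:g^2=e\}|$, and let $\Gamma=\mathfrak{C}(D(G),D(G))$. Then \[rad_D(\Gamma)=\begin{cases}2n-1 & \text{if } \frac{n}{2^r}<2^r,\\ n+2^r(2^r-1)-1 & \text{if } \frac{n}{2^r}\ge 2^r,\end{cases}\qquad diam_D(\Gamma)=\begin{cases}2n-1 & \text{if } \frac{n}{2^r}\le 2^r,\\ n+4^r-1 & \text{if } \frac{n}{2^r}> 2^r.\end{cases}\]
   Context: $D(G)=G\rtimes C_2$, $C_2=\{1,-1\}$, has elements $(g,c)$ with multiplication $(g_1,c_1)(g_2,c_2)=(g_1g_2^{c_1},c_1c_2)$. The commuting graph $\mathfrak{C}(D(G),D(G))$ is the simple graph with vertex set $D(G)$ in which distinct $u,v$ are adjacent iff $uv=vu$. The detour distance $d_D(u,v)$ is the length of a longest $u$–$v$ path; $ecc_D(v)=\max_u d_D(v,u)$; the detour radius $rad_D(\Gamma)$ and detour diameter $diam_D(\Gamma)$ are the minimum and maximum of $ecc_D(v)$ over all vertices $v$. -}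

module Defs where

open import Level using (0ℓ)
open import Data.Nat using (ℕ; suc; _≤_)
open import Data.Fin using (Fin; _≟_)
open import Data.List using (List; []; _∷_; length; filter; allFin)
open import Data.List.Relation.Unary.Unique.Propositional using (Unique)
open import Data.Product using (_×_; _,_; Σ; ∃; ∃-syntax)
open import Data.Sign as Sign using (Sign)
open import Relation.Binary.PropositionalEquality using (_≡_; _≢_)
open import Relation.Nullary using (¬_)
open import Algebra.Core using (Op₁; Op₂)

------------------------------------------------------------------------
-- Simple graphs given by an adjacency relation; paths and detour notions

module Graph {V : Set} (Adj : V → V → Set) where

  -- Chain xs u v : the list xs is a walk starting at u and ending at v,
  -- consecutive vertices adjacent.
  data Chain : List V → V → V → Set where
    single : ∀ x → Chain (x ∷ []) x x
    step   : ∀ {x y ys v} → Adj x y → Chain (y ∷ ys) y v → Chain (x ∷ y ∷ ys) x v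

  -- a u–v path: a walk with pairwise distinct vertices
  IsPath : V → V → List V → Set
  IsPath u v xs = Chain xs u v × Unique xs

  -- the length (number of edges) of a path with vertex list xs is length xs - 1,
  -- so "length d" is encoded as  length xs ≡ suc d.
  -- d is the detour distance: the length of a longest u–v path
  IsDetourDist : V → V → ℕ → Set
  IsDetourDist u v d =
    (∃[ xs ] (IsPath u v xs × length xs ≡ suc d)) ×
    (∀ xs → IsPath u v xs → length xs ≤ suc d)

  -- e is the detour eccentricity of v: max over u of d_D(v,u)
  IsDetourEcc : V → ℕ → Set
  IsDetourEcc v e =
    (∃[ u ] IsDetourDist v u e) ×
    (∀ u d → IsDetourDist v u d → d ≤ e)

  -- detour radius: minimum eccentricity
  IsDetourRadius : ℕ → Set
  IsDetourRadius r =
    (∃[ v ] IsDetourEcc v r) ×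
    (∀ v e → IsDetourEcc v e → r ≤ e)

  -- detour diameter: maximum eccentricity
  IsDetourDiameter : ℕ → Set
  IsDetourDiameter D =
    (∃[ v ] IsDetourEcc v D) ×
    (∀ v e → IsDetourEcc v e → e ≤ D)

------------------------------------------------------------------------
-- Generalized dihedral group D(G) = G ⋊ C₂ for a group on Fin n

module Dihedral {n : ℕ} (_·_ : Op₂ (Fin n)) (e : Fin n) (inv : Op₁ (Fin n)) where

  -- C₂ = {1,-1} is Sign (+ ↦ 1, - ↦ -1)
  D : Set
  D = Fin n × Sign

  -- g ^ c  for c ∈ {1,-1}
  pow : Fin n → Sign → Fin n
  pow g Sign.+ = g
  pow g Sign.- = inv g

  -- (g₁,c₁)(g₂,c₂) = (g₁ g₂^{c₁}, c₁c₂)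
  _∘D_ : D → D → D
  (g₁ , c₁) ∘D (g₂ , c₂) = (g₁ · pow g₂ c₁ , c₁ Sign.* c₂)

  NonAbelianD : Set
  NonAbelianD = ∃[ x ] ∃[ y ] ¬ (x ∘D y ≡ y ∘D x)

  -- adjacency in the commuting graph 𝔆(D(G),D(G))
  CommAdj : D → D → Set
  CommAdj x y = x ≢ y × (x ∘D y ≡ y ∘D x)

  -- number of g ∈ G with g² = e
  involutionCount : ℕ
  involutionCount = length (filter (λ g → (g · g) ≟ e) (allFin n))

module Submission where

-- Detour radius and diameter of the commuting graph of D(G) = G ⋊ C₂.
--
-- Let Ω = {g : g² = e} (a subgroup of order m = 2^r) and write the vertices of
-- D(G) as rotations (g,+) and reflections (g,-).  The commuting graph has three
-- parts: the centre Z = {(g,+) : g ∈ Ω} (m universal vertices), the remaining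
-- n - m rotations (a clique), and the reflections, which split into n/m
-- cliques (one per coset of Ω) with no edges between different cliques or to
-- the non-central rotations.  Hence a path is a sequence of segments, each
-- inside one non-central clique, separated by central vertices.
--
-- Upper bound: counting segments, a path has at most 2n vertices, at most
-- n + m² if it starts outside the centre and at most n + m² - m if it starts
-- in the centre ('pathLength-bound').  Lower bound: weaving the cliques
-- through the central vertices ('weave') realises these bounds from every
-- vertex ('longPath').  So the detour eccentricity of a vertex depends only on
-- its part; the centre gives the radius, the reflections the diameter, and
-- the case distinctions of the theorem are just evaluations of a minimum.
--
-- The theorem is assembled at the end.

open import Defs
open import Data.Nat using (ℕ; _+_; _*_; _∸_; _^_; _<_; _≤_)
open import Data.Fin using (Fin)
open import Data.Product using (_×_)
open import Relation.Binary.PropositionalEquality using (_≡_)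
open import Algebra.Core using (Op₁; Op₂)
open import Algebra.Structures using (IsAbelianGroup)

open import Level using (0ℓ)
open import Data.Nat using (zero; suc; z≤n; s≤s; s≤s⁻¹; _⊓_)
open import Data.Nat.Properties
open import Data.Nat.Tactic.RingSolver using (solve-∀)
open import Data.Product using (Σ; _,_; proj₁; proj₂)
open import Data.Sum using (_⊎_; inj₁; inj₂)
open import Data.Empty using (⊥; ⊥-elim)
open import Relation.Nullary using (¬_; Dec; yes; no)
open import Relation.Nullary.Decidable using (¬?; _×-dec_)
open import Relation.Binary.PropositionalEquality
  using (refl; sym; trans; cong; cong₂; subst; subst₂; _≢_; module ≡-Reasoning)
open import Data.List using (List; []; _∷_; _++_; length; map; concat; filter; allFin; take)
open import Data.Nat.ListAction using (sum)
open import Data.List.Properties using (length-++; length-map; length-tabulate; ++-identityʳ)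
open import Data.List.Relation.Unary.All using (All; []; _∷_)
import Data.List.Relation.Unary.All as All
import Data.List.Relation.Unary.All.Properties as AllP
open import Data.List.Relation.Unary.All.Properties.Core using (¬Any⇒All¬)
open import Data.List.Relation.Unary.Any using (Any; here; there; any?)
open import Data.List.Relation.Unary.AllPairs using (AllPairs; []; _∷_)
import Data.List.Relation.Unary.AllPairs as AP
import Data.List.Relation.Unary.AllPairs.Properties as APP
open import Data.List.Relation.Unary.Linked using (Linked; []; [-]; _∷_)
open import Data.List.Relation.Unary.Unique.Propositional using (Unique)
import Data.List.Relation.Unary.Unique.Propositional.Properties as UP
open import Data.List.Membership.Propositional using (_∈_; _∉_)
open import Data.List.Membership.Propositional.Properties
  using (∈-concat⁻′; ∈-++⁻; ∈-++⁺ˡ; ∈-++⁺ʳ; ∈-map⁺; ∈-map⁻; ∈-filter⁺; ∈-filter⁻; ∈-allFin)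
open import Data.List.Relation.Binary.Disjoint.Propositional using (Disjoint)
open import Data.List.Relation.Binary.Disjoint.Propositional.Properties using (concat⁺ʳ)
import Data.Fin as F
import Data.Fin.Properties as FP
open import Data.Sign as Sign using (Sign)
open import Algebra.Bundles using (AbelianGroup)

module _ {A : Set} where

  -- Deleting one occurrence of an element.
  remove : ∀ {x : A} {ys} → x ∈ ys → List A
  remove {ys = y ∷ ys} (here _)  = ys
  remove {ys = y ∷ ys} (there p) = y ∷ remove p

  length-remove : ∀ {x : A} {ys} (p : x ∈ ys) → suc (length (remove p)) ≡ length ys
  length-remove (here _)  = refl
  length-remove (there p) = cong suc (length-remove p)

  ∈-remove : ∀ {x y : A} {ys} (p : x ∈ ys) → y ∈ ys → y ≢ x → y ∈ remove p
  ∈-remove (here refl) (here refl) y≢x = ⊥-elim (y≢x refl)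
  ∈-remove (here _)    (there q)   _   = q
  ∈-remove (there p)   (here eq)   _   = here eq
  ∈-remove (there p)   (there q)   y≢x = there (∈-remove p q y≢x)

  -- Pigeonhole for lists: a duplicate-free list contained in ys is no longer
  -- than ys.  All cardinality estimates of the proof go through this lemma.
  unique-length-≤ : ∀ (xs ys : List A) → Unique xs → (∀ {x} → x ∈ xs → x ∈ ys) →
                    length xs ≤ length ys
  unique-length-≤ []       ys _           _   = z≤n
  unique-length-≤ (x ∷ xs) ys (x∉xs ∷ uxs) sub =
    subst (suc (length xs) ≤_) (length-remove x∈ys)
      (s≤s (unique-length-≤ xs (remove x∈ys) uxs
        (λ y∈xs → ∈-remove x∈ys (sub (there y∈xs)) (λ eq → All.lookup x∉xs y∈xs (sym eq)))))
    where x∈ys = sub (here refl)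

  totalLength : List (List A) → ℕ
  totalLength bs = sum (map length bs)

  length-concat : ∀ (bs : List (List A)) → length (concat bs) ≡ totalLength bs
  length-concat []       = refl
  length-concat (b ∷ bs) = trans (length-++ b) (cong (length b +_) (length-concat bs))

  -- The last vertex of the list x ∷ xs.
  lastOf : A → List A → A
  lastOf x []       = x
  lastOf x (y ∷ ys) = lastOf y ys

  -- weave bs zs = b₀ ++ z₀ ∷ b₁ ++ z₁ ∷ b₂ ++ …: the blocks bs separated by the
  -- separators zs, stopping as soon as either list runs out.  In the long
  -- paths the blocks are cliques and the separators are central vertices.
  weave : List (List A) → List A → List A
  weave []           zs       = zs
  weave (b ∷ [])     zs       = b ++ zs
  weave (b ∷ _ ∷ _)  []       = b
  weave (b ∷ b' ∷ bs) (z ∷ zs) = b ++ z ∷ weave (b' ∷ bs) zs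

  -- All separators are used, together with the first (#separators + 1) blocks.
  length-weave : ∀ bs zs →
    length (weave bs zs) ≡ totalLength (take (suc (length zs)) bs) + length zs
  length-weave [] zs = refl
  length-weave (b ∷ []) []       = trans (length-++ b) (sym (+-identityʳ (length b + 0)))
  length-weave (b ∷ []) (z ∷ zs) = trans (length-++ b) (cong (_+ suc (length zs)) (sym (+-identityʳ (length b))))
  length-weave (b ∷ b' ∷ bs) [] = sym (trans (+-identityʳ _) (+-identityʳ _))
  length-weave (b ∷ b' ∷ bs) (z ∷ zs) = begin
      length (b ++ z ∷ weave (b' ∷ bs) zs)
    ≡⟨ length-++ b ⟩
      length b + suc (length (weave (b' ∷ bs) zs))
    ≡⟨ cong (λ t → length b + suc t) (length-weave (b' ∷ bs) zs) ⟩
      length b + suc (S + length zs)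
    ≡⟨ cong (length b +_) (sym (+-suc S (length zs))) ⟩
      length b + (S + suc (length zs))
    ≡⟨ sym (+-assoc (length b) S (suc (length zs))) ⟩
      length b + S + suc (length zs) ∎
    where
    open ≡-Reasoning
    S = totalLength (take (suc (length zs)) (b' ∷ bs))

  ∈-weave⁻ : ∀ {x} bs zs → x ∈ weave bs zs → x ∈ concat bs ⊎ x ∈ zs
  ∈-weave⁻ [] zs p = inj₂ p
  ∈-weave⁻ (b ∷ []) zs p with ∈-++⁻ b p
  ... | inj₁ q = inj₁ (∈-++⁺ˡ q)
  ... | inj₂ q = inj₂ q
  ∈-weave⁻ (b ∷ b' ∷ bs) [] p = inj₁ (∈-++⁺ˡ p)
  ∈-weave⁻ (b ∷ b' ∷ bs) (z ∷ zs) p with ∈-++⁻ b p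
  ... | inj₁ q          = inj₁ (∈-++⁺ˡ q)
  ... | inj₂ (here eq)  = inj₂ (here eq)
  ... | inj₂ (there q) with ∈-weave⁻ (b' ∷ bs) zs q
  ...   | inj₁ r = inj₁ (∈-++⁺ʳ b r)
  ...   | inj₂ r = inj₂ (there r)

  -- Weaving pairwise disjoint duplicate-free blocks through distinct separators
  -- (disjoint from the blocks) produces no repetition.
  unique-weave : ∀ bs zs → All Unique bs → AllPairs Disjoint bs → Unique zs →
                 Disjoint (concat bs) zs → Unique (weave bs zs)
  unique-weave [] zs _ _ uz _ = uz
  unique-weave (b ∷ []) zs (ub ∷ []) _ uz d = UP.++⁺ ub uz (λ { (p , q) → d (∈-++⁺ˡ p , q) })
  unique-weave (b ∷ b' ∷ bs) [] (ub ∷ _) _ _ _ = ub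
  unique-weave (b ∷ b' ∷ bs) (z ∷ zs) (ub ∷ ubs) (db ∷ dbs) (z∉zs ∷ uz) d =
    UP.++⁺ ub (¬Any⇒All¬ w z∉w ∷ uw) b-disjoint
    where
    w = weave (b' ∷ bs) zs
    uw : Unique w
    uw = unique-weave (b' ∷ bs) zs ubs dbs uz (λ { (p , q) → d (∈-++⁺ʳ b p , there q) })
    z∉w : z ∉ w
    z∉w p with ∈-weave⁻ (b' ∷ bs) zs p
    ... | inj₁ r = d (∈-++⁺ʳ b r , here refl)
    ... | inj₂ r = All.lookup z∉zs r refl
    b-disjoint : Disjoint b (z ∷ w)
    b-disjoint (p , here refl) = d (∈-++⁺ˡ p , here refl)
    b-disjoint (p , there q) with ∈-weave⁻ (b' ∷ bs) zs q
    ... | inj₁ r = concat⁺ʳ db (p , r)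
    ... | inj₂ r = d (∈-++⁺ˡ p , there r)

module _ {A : Set} {R : A → A → Set} where

  -- z is related to every element, on both sides.
  Universal : A → Set
  Universal z = (∀ y → R y z) × (∀ y → R z y)

  -- A list whose elements are pairwise related (via a predicate) is linked.
  linked-all : ∀ {P : A → Set} → (∀ {x y} → P x → P y → R x y) → ∀ {xs} → All P xs → Linked R xs
  linked-all h []           = []
  linked-all h (p ∷ [])     = [-]
  linked-all h (p ∷ q ∷ ps) = h p q ∷ linked-all h (q ∷ ps)

  linked-universal : ∀ {zs} → All Universal zs → Linked R zs
  linked-universal = linked-all (λ _ uy → proj₁ uy _)

  -- Two linked lists joined by a universal element form a linked list.
  linked-join : ∀ {z} (xs : List A) {ys} → Universal z →
                Linked R xs → Linked R ys → Linked R (xs ++ z ∷ ys)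
  linked-join []           uz _        []      = [-]
  linked-join []           uz _        [-]     = proj₂ uz _ ∷ [-]
  linked-join []           uz _        (r ∷ l) = proj₂ uz _ ∷ r ∷ l
  linked-join (x ∷ [])     uz _        ly      = proj₁ uz x ∷ linked-join [] uz [] ly
  linked-join (x ∷ x' ∷ xs) uz (r ∷ lx) ly     = r ∷ linked-join (x' ∷ xs) uz lx ly

  -- Linked blocks woven through universal separators give a linked list.
  linked-weave : ∀ bs zs → All (Linked R) bs → All Universal zs → Linked R (weave bs zs)
  linked-weave []            zs       _          uz         = linked-universal uz
  linked-weave (b ∷ [])      []       (lb ∷ [])  _          = subst (Linked R) (sym (++-identityʳ b)) lb
  linked-weave (b ∷ [])      (z ∷ zs) (lb ∷ [])  (u ∷ uz)   = linked-join b u lb (linked-universal uz)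
  linked-weave (b ∷ b' ∷ bs) []       (lb ∷ _)   _          = lb
  linked-weave (b ∷ b' ∷ bs) (z ∷ zs) (lb ∷ lbs) (u ∷ uz)   =
    linked-join b u lb (linked-weave (b' ∷ bs) zs lbs uz)

  -- Paths of the simple graph "x ≢ y and R x y" are exactly the linked,
  -- duplicate-free vertex lists.
  linked⇒chain : ∀ x xs → Linked R (x ∷ xs) → Unique (x ∷ xs) →
                 Graph.Chain (λ a b → a ≢ b × R a b) (x ∷ xs) x (lastOf x xs)
  linked⇒chain x []       _        _                = Graph.single x
  linked⇒chain x (y ∷ ys) (r ∷ lk) ((x≢y ∷ _) ∷ u) = Graph.step (x≢y , r) (linked⇒chain y ys lk u)

  chain⇒linked : ∀ {xs u v} → Graph.Chain (λ a b → a ≢ b × R a b) xs u v → Linked R xs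
  chain⇒linked (Graph.single x)                    = [-]
  chain⇒linked (Graph.step a (Graph.single x))     = proj₂ a ∷ [-]
  chain⇒linked (Graph.step a c@(Graph.step _ _))   = proj₂ a ∷ chain⇒linked c

4^r≡2^r*2^r : ∀ r → 4 ^ r ≡ 2 ^ r * 2 ^ r
4^r≡2^r*2^r zero    = refl
4^r≡2^r*2^r (suc r) = trans (cong (4 *_) (4^r≡2^r*2^r r)) (square-double (2 ^ r))
  where
  square-double : ∀ x → 4 * (x * x) ≡ (2 * x) * (2 * x)
  square-double = solve-∀

-- Arithmetic of the path-length bound.  For a path with z central vertices,
-- a non-central rotations and b reflections, where h ∈ {0,1} records whether
-- non-central rotations occur, the segment count gives  b + M h ≤ M (z + 1)
-- (or M z for a path starting in the centre).  Together with z ≤ M,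
-- z + a ≤ N and 2M ≤ N this bounds the number of vertices.
pathSize-outside : ∀ M N z a b h → z ≤ M → z + a ≤ N → M + M ≤ N → (h ≡ 0 → a ≡ 0) →
                   (h ≡ 0 ⊎ h ≡ 1) → b + M * h ≤ M * (z + 1) → z + a + b ≤ N + M * M
pathSize-outside M N z a b .1 zM zaN MMN _ (inj₂ refl) hb =
  +-mono-≤ zaN (≤-trans b≤Mz (*-monoʳ-≤ M zM))
  where
  b≤Mz : b ≤ M * z
  b≤Mz = +-cancelʳ-≤ M b (M * z) (subst₂ _≤_ (cong (b +_) (*-identityʳ M))
           (trans (*-distribˡ-+ M z 1) (cong (M * z +_) (*-identityʳ M))) hb)
pathSize-outside M N z a b .0 zM zaN MMN a≡0 (inj₁ refl) hb rewrite a≡0 refl = begin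
    z + 0 + b         ≤⟨ +-mono-≤ (≤-reflexive (+-identityʳ z)) b≤ ⟩
    z + M * (M + 1)   ≤⟨ +-monoˡ-≤ (M * (M + 1)) zM ⟩
    M + M * (M + 1)   ≡⟨ regroup M ⟩
    (M + M) + M * M   ≤⟨ +-monoˡ-≤ (M * M) MMN ⟩
    N + M * M         ∎
  where
  open ≤-Reasoning
  regroup : ∀ M → M + M * (M + 1) ≡ (M + M) + M * M
  regroup = solve-∀
  b≤ : b ≤ M * (M + 1)
  b≤ = ≤-trans (subst (_≤ M * (z + 1)) (trans (cong (b +_) (*-zeroʳ M)) (+-identityʳ b)) hb)
               (*-monoʳ-≤ M (+-monoˡ-≤ 1 zM))

pathSize-central : ∀ M N z a b h → z ≤ M → z + a ≤ N → M + M ≤ N → (h ≡ 0 → a ≡ 0) →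
                   (h ≡ 0 ⊎ h ≡ 1) → b + M * h ≤ M * (z + 0) → z + a + b ≤ N + M * M ∸ M
pathSize-central M N z a b .1 zM zaN MMN _ (inj₂ refl) hb = m+n≤o⇒m≤o∸n (z + a + b) (begin
    z + a + b + M         ≡⟨ regroup (z + a) b M ⟩
    (z + a) + (b + M * 1) ≤⟨ +-mono-≤ zaN (≤-trans hb (*-monoʳ-≤ M (≤-trans (≤-reflexive (+-identityʳ z)) zM))) ⟩
    N + M * M             ∎)
  where
  open ≤-Reasoning
  regroup : ∀ x b M → x + b + M ≡ x + (b + M * 1)
  regroup = solve-∀
pathSize-central M N z a b .0 zM zaN MMN a≡0 (inj₁ refl) hb rewrite a≡0 refl = m+n≤o⇒m≤o∸n (z + 0 + b) (begin
    z + 0 + b + M     ≡⟨ drop0 z b M ⟩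
    z + b + M         ≤⟨ +-monoˡ-≤ M (+-mono-≤ zM b≤) ⟩
    M + M * M + M     ≡⟨ regroup M ⟩
    (M + M) + M * M   ≤⟨ +-monoˡ-≤ (M * M) MMN ⟩
    N + M * M         ∎)
  where
  open ≤-Reasoning
  drop0 : ∀ z b M → z + 0 + b + M ≡ z + b + M
  drop0 = solve-∀
  regroup : ∀ M → M + M * M + M ≡ (M + M) + M * M
  regroup = solve-∀
  b≤ : b ≤ M * M
  b≤ = ≤-trans (subst (_≤ M * (z + 0)) (trans (cong (b +_) (*-zeroʳ M)) (+-identityʳ b)) hb)
               (*-monoʳ-≤ M (≤-trans (≤-reflexive (+-identityʳ z)) zM))

-- Arithmetic of the long paths.  A long path weaves a rotation block of
-- size Y (with N ≤ Y + M) and K reflection blocks of size M (N ≤ K M)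
-- through the M = p + 1 central vertices; its size reaches the claimed
-- maximum  min(2N, N + M²)  (resp. min(2N, N + M² - M) from the centre).
weaveSize-rotation : ∀ p M N Y K → M ≡ suc p → N ≤ Y + M → N ≤ K * M →
                     (N + N) ⊓ (N + M * M) ≤ Y + M * (suc p ⊓ K) + suc p
weaveSize-rotation p .(suc p) N Y K refl hY hK with ≤-total (suc p) K
... | inj₁ le rewrite m≤n⇒m⊓n≡m le =
  ≤-trans (m⊓n≤n _ _) (≤-trans (+-monoˡ-≤ (M * M) hY) (≤-reflexive (regroup Y M)))
  where
  M = suc p
  regroup : ∀ Y M → Y + M + M * M ≡ Y + M * M + M
  regroup = solve-∀
... | inj₂ le rewrite m≥n⇒m⊓n≡n le =
  ≤-trans (m⊓n≤m _ _) (≤-trans (+-mono-≤ hY hK) (≤-reflexive (regroup Y M K)))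
  where
  M = suc p
  regroup : ∀ Y M K → Y + M + K * M ≡ Y + M * K + M
  regroup = solve-∀

-- From a reflection: one reflection block of size M precedes the rotation block.
weaveSize-reflection : ∀ p M N Y r → M ≡ suc p → N ≤ Y + M → N ≤ suc r * M →
                       (N + N) ⊓ (N + M * M) ≤ M + (Y + M * (p ⊓ r)) + suc p
weaveSize-reflection p M N Y r eq hY hK =
  subst ((N + N) ⊓ (N + M * M) ≤_) reorder (weaveSize-rotation p M N Y (suc r) eq hY hK)
  where
  regroup : ∀ M Y t P → Y + (M + M * t) + P ≡ M + (Y + M * t) + P
  regroup = solve-∀
  reorder : Y + M * (suc p ⊓ suc r) + suc p ≡ M + (Y + M * (p ⊓ r)) + suc p
  reorder = trans (cong (λ t → Y + t + suc p) (*-suc M (p ⊓ r))) (regroup M Y (p ⊓ r) (suc p))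

-- From a central vertex: it is the first vertex, leaving p separators.
weaveSize-central : ∀ p M N Y K → M ≡ suc p → N ≤ Y + M → N ≤ K * M →
                    (N + N) ⊓ (N + M * M ∸ M) ≤ suc (Y + M * (p ⊓ K) + p)
weaveSize-central p .(suc p) N Y K refl hY hK with ≤-total p K
... | inj₁ le rewrite m≤n⇒m⊓n≡m le =
  ≤-trans (m⊓n≤n _ _) (≤-trans (≤-reflexive N+M²∸M) (≤-trans (+-monoˡ-≤ (M * p) hY) (≤-reflexive (regroup Y p))))
  where
  M = suc p
  N+M²∸M : N + M * M ∸ M ≡ N + M * p
  N+M²∸M = trans (cong (λ t → N + t ∸ M) (*-suc M p))
            (trans (cong (_∸ M) (+-swap N M (M * p))) (m+n∸n≡m (N + M * p) M))
    where
    +-swap : ∀ N M X → N + (M + X) ≡ N + X + M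
    +-swap = solve-∀
  regroup : ∀ Y p → Y + suc p + suc p * p ≡ suc (Y + suc p * p + p)
  regroup = solve-∀
... | inj₂ le rewrite m≥n⇒m⊓n≡n le =
  ≤-trans (m⊓n≤m _ _) (≤-trans (+-mono-≤ hY hK) (≤-reflexive (regroup Y p K)))
  where
  regroup : ∀ Y p K → Y + suc p + K * suc p ≡ suc (Y + suc p * K + p)
  regroup = solve-∀

-- The three parts of the vertex set: the centre, the non-central rotations
-- and the reflections.
data Part : Set where
  central rotation reflection : Part

module CommutingGraph (n : ℕ) (_·_ : Op₂ (Fin n)) (e : Fin n) (inv : Op₁ (Fin n))
                      (isAbelianGroup : IsAbelianGroup _≡_ _·_ e inv) where

  abelianGroup : AbelianGroup 0ℓ 0ℓ
  abelianGroup = record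
    { Carrier = Fin n ; _≈_ = _≡_ ; _∙_ = _·_ ; ε = e ; _⁻¹ = inv ; isAbelianGroup = isAbelianGroup }

  open AbelianGroup abelianGroup using (assoc; comm; identityˡ; identityʳ; inverseˡ; inverseʳ; commutativeSemigroup)
  open import Algebra.Properties.AbelianGroup abelianGroup
    using (∙-cancelˡ; inverseʳ-unique; ⁻¹-involutive; ε⁻¹≈ε; ⁻¹-∙-comm; xyx⁻¹≈y)
  open import Algebra.Properties.CommutativeSemigroup commutativeSemigroup using (interchange)
  open Dihedral _·_ e inv

  -- Ω = {g : g² = e}, a subgroup of G
  InΩ : Fin n → Set
  InΩ a = a · a ≡ e

  InΩ? : (a : Fin n) → Dec (InΩ a)
  InΩ? a = (a · a) F.≟ e

  Ω-e : InΩ e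
  Ω-e = identityˡ e

  Ω-inv : ∀ {a} → InΩ a → InΩ (inv a)
  Ω-inv {a} a²≡e = trans (⁻¹-∙-comm a a) (trans (cong inv a²≡e) ε⁻¹≈ε)

  Ω-mul : ∀ {a b} → InΩ a → InΩ b → InΩ (a · b)
  Ω-mul {a} {b} a²≡e b²≡e = trans (interchange a b a b) (trans (cong₂ _·_ a²≡e b²≡e) (identityˡ e))

  Ω⇒self-inverse : ∀ {a} → InΩ a → a ≡ inv a
  Ω⇒self-inverse {a} = inverseʳ-unique a a

  self-inverse⇒Ω : ∀ {a} → a ≡ inv a → InΩ a
  self-inverse⇒Ω {a} eq = trans (cong (a ·_) eq) (inverseʳ a)

  -- a and b lie in the same coset of Ω: an equivalence relation
  SameCoset : Fin n → Fin n → Set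
  SameCoset a b = InΩ (a · inv b)

  SameCoset? : ∀ a b → Dec (SameCoset a b)
  SameCoset? a b = InΩ? (a · inv b)

  inv-div : ∀ a b → inv (a · inv b) ≡ b · inv a
  inv-div a b = begin
    inv (a · inv b)         ≡⟨ sym (⁻¹-∙-comm a (inv b)) ⟩
    inv a · inv (inv b)     ≡⟨ cong (inv a ·_) (⁻¹-involutive b) ⟩
    inv a · b               ≡⟨ comm (inv a) b ⟩
    b · inv a               ∎
    where open ≡-Reasoning

  div-mul : ∀ a b → (a · inv b) · b ≡ a
  div-mul a b = trans (assoc a (inv b) b) (trans (cong (a ·_) (inverseˡ b)) (identityʳ a))

  div-trans : ∀ a b c → (a · inv b) · (b · inv c) ≡ a · inv c
  div-trans a b c = begin
    (a · inv b) · (b · inv c)   ≡⟨ sym (assoc (a · inv b) b (inv c)) ⟩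
    ((a · inv b) · b) · inv c   ≡⟨ cong (_· inv c) (div-mul a b) ⟩
    a · inv c                   ∎
    where open ≡-Reasoning

  SameCoset-refl : ∀ a → SameCoset a a
  SameCoset-refl a = subst InΩ (sym (inverseʳ a)) Ω-e

  SameCoset-sym : ∀ {a b} → SameCoset a b → SameCoset b a
  SameCoset-sym {a} {b} s = subst InΩ (inv-div a b) (Ω-inv s)

  SameCoset-trans : ∀ {a b c} → SameCoset a b → SameCoset b c → SameCoset a c
  SameCoset-trans {a} {b} {c} s t = subst InΩ (div-trans a b c) (Ω-mul s t)

  -- Ω itself is the coset of e.
  SameCoset-Ω : ∀ {a b} → SameCoset a b → InΩ b → InΩ a
  SameCoset-Ω {a} {b} s b∈Ω = subst InΩ (div-mul a b) (Ω-mul s b∈Ω)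

  Ω-SameCoset : ∀ {a b} → InΩ a → InΩ b → SameCoset a b
  Ω-SameCoset a∈Ω b∈Ω = Ω-mul a∈Ω (Ω-inv b∈Ω)

  -- When do two elements of D(G) commute?  Rotations always commute; a
  -- rotation (g,+) commutes with a reflection iff g ∈ Ω; two reflections
  -- commute iff they lie over the same coset of Ω.
  Commute : D → D → Set
  Commute x y = x ∘D y ≡ y ∘D x

  commute-rotations : ∀ g h → Commute (g , Sign.+) (h , Sign.+)
  commute-rotations g h = cong (_, Sign.+) (comm g h)

  commute-rotation-reflection : ∀ {g} h → InΩ g → Commute (g , Sign.+) (h , Sign.-)
  commute-rotation-reflection {g} h g∈Ω =
    cong (_, Sign.-) (trans (comm g h) (cong (h ·_) (Ω⇒self-inverse g∈Ω)))

  commute-rotation-reflection⁻ : ∀ {g h} → Commute (g , Sign.+) (h , Sign.-) → InΩ g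
  commute-rotation-reflection⁻ {g} {h} c =
    self-inverse⇒Ω (∙-cancelˡ h g (inv g) (trans (comm h g) (cong proj₁ c)))

  commute-reflections : ∀ {g h} → SameCoset g h → Commute (g , Sign.-) (h , Sign.-)
  commute-reflections {g} {h} s = cong (_, Sign.+) (trans (Ω⇒self-inverse s) (inv-div g h))

  commute-reflections⁻ : ∀ {g h} → Commute (g , Sign.-) (h , Sign.-) → SameCoset g h
  commute-reflections⁻ {g} {h} c = self-inverse⇒Ω (trans (cong proj₁ c) (sym (inv-div g h)))

  -- The centre of D(G) is {(g,+) : g ∈ Ω}.
  IsCentral : D → Set
  IsCentral (g , s) = s ≡ Sign.+ × InΩ g

  central-universal : ∀ {z} → IsCentral z → Universal {R = Commute} z
  central-universal {g , .Sign.+} (refl , g∈Ω) = commutesˡ , λ y → sym (commutesˡ y)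
    where
    commutesˡ : ∀ y → Commute y (g , Sign.+)
    commutesˡ (h , Sign.+) = commute-rotations h g
    commutesˡ (h , Sign.-) = sym (commute-rotation-reflection h g∈Ω)

  -- D(G) is abelian when Ω = G, so the hypothesis provides a ∉ Ω.
  nonAbelian⇒notΩ : NonAbelianD → Σ (Fin n) λ a → ¬ InΩ a
  nonAbelian⇒notΩ (x , y , x∘y≢y∘x) = FP.¬∀⟶∃¬ n InΩ InΩ? (λ all → x∘y≢y∘x (allCommute all x y))
    where
    allCommute : (∀ g → InΩ g) → ∀ x y → Commute x y
    allCommute all (g , Sign.+) (h , Sign.+) = commute-rotations g h
    allCommute all (g , Sign.+) (h , Sign.-) = commute-rotation-reflection h (all g)
    allCommute all (g , Sign.-) (h , Sign.+) = sym (commute-rotation-reflection g (all h))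
    allCommute all (g , Sign.-) (h , Sign.-) = commute-reflections (all (g · inv h))

  -- The coset gΩ as a duplicate-free list starting with g.
  nonTrivialΩ? : (i : Fin n) → Dec (¬ (i ≡ e) × InΩ i)
  nonTrivialΩ? i = ¬? (i F.≟ e) ×-dec InΩ? i

  Ω∖e : List (Fin n)
  Ω∖e = filter nonTrivialΩ? (allFin n)

  coset : Fin n → List (Fin n)
  coset g = g ∷ map (g ·_) Ω∖e

  coset-unique : ∀ g → Unique (coset g)
  coset-unique g =
    All.tabulate g∉ ∷ UP.map⁺ (λ {x} {y} → ∙-cancelˡ g x y) (UP.filter⁺ nonTrivialΩ? (UP.allFin⁺ n))
    where
    g∉ : ∀ {y} → y ∈ map (g ·_) Ω∖e → g ≢ y
    g∉ p g≡y with ∈-map⁻ (g ·_) p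
    ... | i , i∈ , refl =
      proj₁ (proj₂ (∈-filter⁻ nonTrivialΩ? {xs = allFin n} i∈)) (sym (∙-cancelˡ g e i (trans (identityʳ g) g≡y)))

  coset-sound : ∀ g → All (λ h → SameCoset h g) (coset g)
  coset-sound g = SameCoset-refl g ∷ All.tabulate sound
    where
    sound : ∀ {y} → y ∈ map (g ·_) Ω∖e → SameCoset y g
    sound p with ∈-map⁻ (g ·_) p
    ... | i , i∈ , refl = subst InΩ (sym (xyx⁻¹≈y g i)) (proj₂ (proj₂ (∈-filter⁻ nonTrivialΩ? {xs = allFin n} i∈)))

  coset-complete : ∀ g h → SameCoset h g → h ∈ coset g
  coset-complete g h s with h F.≟ g
  ... | yes refl = here refl
  ... | no h≢g   = there (subst (_∈ map (g ·_) _) g·[h·g⁻¹]≡h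
                    (∈-map⁺ (g ·_) (∈-filter⁺ nonTrivialΩ? (∈-allFin (h · inv g)) (h·g⁻¹≢e , s))))
    where
    g·[h·g⁻¹]≡h : g · (h · inv g) ≡ h
    g·[h·g⁻¹]≡h = trans (comm g (h · inv g)) (div-mul h g)
    h·g⁻¹≢e : ¬ (h · inv g ≡ e)
    h·g⁻¹≢e eq = h≢g (trans (sym (div-mul h g)) (trans (cong (_· g) eq) (identityˡ g)))

  -- m = |Ω|; every coset has m elements.
  m : ℕ
  m = involutionCount

  m≡|eΩ| : m ≡ length (coset e)
  m≡|eΩ| = ≤-antisym
    (unique-length-≤ Ω (coset e) (UP.filter⁺ InΩ? (UP.allFin⁺ n))
      (λ {h} p → coset-complete e h (Ω-SameCoset (∈-filter⁻ InΩ? {xs = allFin n} p .proj₂) Ω-e)))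
    (unique-length-≤ (coset e) Ω (coset-unique e)
      (λ {h} p → ∈-filter⁺ InΩ? (∈-allFin h) (SameCoset-Ω (All.lookup (coset-sound e) p) Ω-e)))
    where Ω = filter InΩ? (allFin n)

  length-coset : ∀ g → length (coset g) ≡ m
  length-coset g = trans (cong suc (trans (length-map (g ·_) Ω∖e) (sym (length-map (e ·_) Ω∖e)))) (sym m≡|eΩ|)

  length-allFin : length (allFin n) ≡ n
  length-allFin = length-tabulate (λ x → x)

  -- Two disjoint cosets Ω and aΩ fit into G: 2m ≤ n.
  m+m≤n : ∀ a → ¬ InΩ a → m + m ≤ n
  m+m≤n a a∉Ω = subst₂ _≤_ (trans (length-++ (coset e)) (cong₂ _+_ (length-coset e) (length-coset a))) length-allFin
    (unique-length-≤ (coset e ++ coset a) (allFin n)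
      (UP.++⁺ (coset-unique e) (coset-unique a) disjoint) (λ {h} _ → ∈-allFin h))
    where
    disjoint : Disjoint (coset e) (coset a)
    disjoint (p , q) = a∉Ω (SameCoset-Ω (SameCoset-sym (All.lookup (coset-sound a) q))
                                        (SameCoset-Ω (All.lookup (coset-sound e) p) Ω-e))

  -- The reflections over a coset gΩ: a clique of m reflections.
  reflectionCoset : Fin n → List D
  reflectionCoset g = map (_, Sign.-) (coset g)

  OverCoset : Fin n → D → Set
  OverCoset g y = Σ (Fin n) λ h → y ≡ (h , Sign.-) × SameCoset h g

  OverCoset⇒∈ : ∀ {g y} → OverCoset g y → y ∈ reflectionCoset g
  OverCoset⇒∈ {g} (h , refl , s) = ∈-map⁺ (_, Sign.-) (coset-complete g h s)

  ∈⇒OverCoset : ∀ {g y} → y ∈ reflectionCoset g → OverCoset g y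
  ∈⇒OverCoset {g} p with ∈-map⁻ (_, Sign.-) p
  ... | h , h∈ , refl = h , refl , All.lookup (coset-sound g) h∈

  length-reflectionCoset : ∀ g → length (reflectionCoset g) ≡ m
  length-reflectionCoset g = trans (length-map _ (coset g)) (length-coset g)

  reflectionCoset-unique : ∀ g → Unique (reflectionCoset g)
  reflectionCoset-unique g = UP.map⁺ (cong proj₁) (coset-unique g)

  reflectionCoset-linked : ∀ g → Linked Commute (reflectionCoset g)
  reflectionCoset-linked g = linked-all {P = OverCoset g}
    (λ { (h , refl , s) (h' , refl , s') → commute-reflections (SameCoset-trans s (SameCoset-sym s')) })
    (All.tabulate ∈⇒OverCoset)

  -- The centre, listed as the rotations over a coset gΩ with g ∈ Ω.
  centreFrom : Fin n → List D
  centreFrom g = map (_, Sign.+) (coset g)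

  centreFrom-central : ∀ g → InΩ g → All IsCentral (centreFrom g)
  centreFrom-central g g∈Ω = All.tabulate λ p → let (h , h∈ , eq) = ∈-map⁻ (_, Sign.+) p in
    subst IsCentral (sym eq) (refl , SameCoset-Ω (All.lookup (coset-sound g) h∈) g∈Ω)

  centreFrom-unique : ∀ g → Unique (centreFrom g)
  centreFrom-unique g = UP.map⁺ (cong proj₁) (coset-unique g)

  length-centreFrom : ∀ g → length (centreFrom g) ≡ m
  length-centreFrom g = trans (length-map _ (coset g)) (length-coset g)

  partOf : D → Part
  partOf (g , Sign.+) with InΩ? g
  ... | yes _ = central
  ... | no _  = rotation
  partOf (g , Sign.-) = reflection

  partOf-central : ∀ {g} → InΩ g → partOf (g , Sign.+) ≡ central
  partOf-central {g} g∈Ω with InΩ? g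
  ... | yes _   = refl
  ... | no g∉Ω = ⊥-elim (g∉Ω g∈Ω)

  partOf-rotation : ∀ {g} → ¬ InΩ g → partOf (g , Sign.+) ≡ rotation
  partOf-rotation {g} g∉Ω with InΩ? g
  ... | yes g∈Ω = ⊥-elim (g∉Ω g∈Ω)
  ... | no _    = refl

  central-part : ∀ x → partOf x ≡ central → IsCentral x
  central-part (g , Sign.+) eq with InΩ? g
  central-part (g , Sign.+) eq  | yes g∈Ω = refl , g∈Ω
  central-part (g , Sign.+) () | no _
  central-part (g , Sign.-) ()

  rotation-part : ∀ x → partOf x ≡ rotation → Σ (Fin n) λ g → x ≡ (g , Sign.+) × ¬ InΩ g
  rotation-part (g , Sign.+) eq with InΩ? g
  rotation-part (g , Sign.+) eq  | no g∉Ω = g , refl , g∉Ω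
  rotation-part (g , Sign.+) () | yes _
  rotation-part (g , Sign.-) ()

  reflection-part : ∀ x → partOf x ≡ reflection → Σ (Fin n) λ g → x ≡ (g , Sign.-)
  reflection-part (g , Sign.-) _ = g , refl
  reflection-part (g , Sign.+) eq with InΩ? g
  reflection-part (g , Sign.+) () | yes _
  reflection-part (g , Sign.+) () | no _

  -- No edge joins a non-central rotation to a reflection.
  rotation-reflection-apart : ∀ x y → partOf x ≡ rotation → partOf y ≡ reflection → ¬ Commute x y
  rotation-reflection-apart x y px py c with rotation-part x px | reflection-part y py
  ... | g , refl , g∉Ω | h , refl = g∉Ω (commute-rotation-reflection⁻ c)

  _≟ₚ_ : (k l : Part) → Dec (k ≡ l)
  central     ≟ₚ central     = yes refl
  central     ≟ₚ rotation    = no λ ()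
  central     ≟ₚ reflection  = no λ ()
  rotation    ≟ₚ central     = no λ ()
  rotation    ≟ₚ rotation    = yes refl
  rotation    ≟ₚ reflection  = no λ ()
  reflection  ≟ₚ central     = no λ ()
  reflection  ≟ₚ rotation    = no λ ()
  reflection  ≟ₚ reflection  = yes refl

  -- Statistics of a vertex list used to bound the length of a path.
  inPart : Part → List D → List D
  inPart k = filter (λ x → partOf x ≟ₚ k)

  count : Part → List D → ℕ
  count k xs = length (inPart k xs)

  -- 1 if some non-central rotation occurs, else 0
  hasRotation : List D → ℕ
  hasRotation [] = 0
  hasRotation (x ∷ xs) with partOf x
  ... | rotation = 1
  ... | _        = hasRotation xs

  -- 1 outside the centre, 0 in it
  outside : Part → ℕ
  outside central = 0
  outside _       = 1

  startsOutside : List D → ℕ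
  startsOutside []      = 0
  startsOutside (x ∷ _) = outside (partOf x)

  -- 1 if the list starts at a reflection, else 0
  startsAtReflection : List D → ℕ
  startsAtReflection [] = 0
  startsAtReflection (x ∷ _) with partOf x
  ... | reflection = 1
  ... | _          = 0

  -- the initial segment of reflections
  leadingReflections : List D → List D
  leadingReflections [] = []
  leadingReflections (x ∷ xs) with partOf x
  ... | reflection = x ∷ leadingReflections xs
  ... | _          = []

  leadingReflections-⊆ : ∀ {y} xs → y ∈ leadingReflections xs → y ∈ xs
  leadingReflections-⊆ (x ∷ xs) p with partOf x
  leadingReflections-⊆ (x ∷ xs) (here eq) | reflection = here eq
  leadingReflections-⊆ (x ∷ xs) (there p) | reflection = there (leadingReflections-⊆ xs p)

  leadingReflections-unique : ∀ xs → Unique xs → Unique (leadingReflections xs)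
  leadingReflections-unique [] _ = []
  leadingReflections-unique (x ∷ xs) (x∉xs ∷ u) with partOf x
  ... | central    = []
  ... | rotation   = []
  ... | reflection =
    All.tabulate (λ p → All.lookup x∉xs (leadingReflections-⊆ xs p)) ∷ leadingReflections-unique xs u

  -- Commuting reflections lie over the same coset, so a commuting run of
  -- reflections stays over the coset of its first vertex ...
  leadingReflections-over : ∀ g x xs → OverCoset g x → Linked Commute (x ∷ xs) →
                            All (OverCoset g) (leadingReflections xs)
  leadingReflections-over g x [] _ _ = []
  leadingReflections-over g x (y ∷ ys) x-over (c ∷ lk) with partOf y in py
  ... | central  = []
  ... | rotation = []
  ... | reflection with reflection-part y py | x-over
  ... | h' , refl | h , refl , s = y-over ∷ leadingReflections-over g _ ys y-over lk
    where
    y-over : OverCoset g (h' , Sign.-)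
    y-over = h' , refl , SameCoset-trans (SameCoset-sym (commute-reflections⁻ c)) s

  -- ... and therefore has at most m vertices.
  leadingReflections-≤ : ∀ xs → Linked Commute xs → Unique xs →
                         length (leadingReflections xs) ≤ m * startsAtReflection xs
  leadingReflections-≤ [] _ _ = z≤n
  leadingReflections-≤ (x ∷ xs) lk u with partOf x in px
  ... | central  = z≤n
  ... | rotation = z≤n
  ... | reflection with reflection-part x px
  ... | g , refl = subst (suc (length (leadingReflections xs)) ≤_)
                     (trans (length-reflectionCoset g) (sym (*-identityʳ m)))
                     (unique-length-≤ _ (reflectionCoset g) (leadingReflections-unique (x ∷ xs) u)
                       (λ p → OverCoset⇒∈ (All.lookup run-over p)))
    where
    g-over : OverCoset g (g , Sign.-)
    g-over = g , refl , SameCoset-refl g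
    run-over : All (OverCoset g) ((g , Sign.-) ∷ leadingReflections xs)
    run-over = g-over ∷ leadingReflections-over g _ xs g-over lk

  -- Arithmetic steps of the segment invariant below, one for each way a
  -- path can be extended at its start.
  step-central : ∀ M b a z d → d ≤ 1 → b + M * a ≤ M * (z + d) → b + M * a + M * 0 ≤ M * (suc z + 0) + 0
  step-central M b a z d d≤1 h rewrite *-zeroʳ M | +-identityʳ (b + M * a) | +-identityʳ z | +-identityʳ (M * suc z) =
    ≤-trans h (*-monoʳ-≤ M (≤-trans (+-monoʳ-≤ z d≤1) (≤-reflexive (+-comm z 1))))

  step-enter-rotations : ∀ M b a z → b + M * a ≤ M * (z + 0) → b + M * 1 + M * 0 ≤ M * (z + 1) + 0
  step-enter-rotations M b a z h rewrite *-zeroʳ M | +-identityʳ (b + M * 1) | +-identityʳ (M * (z + 1))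
                                       | *-distribˡ-+ M z 1 | *-identityʳ M | +-identityʳ z =
    +-monoˡ-≤ M (≤-trans (m≤m+n b (M * a)) h)

  step-stay-rotations : ∀ M b z → b + M * 1 ≤ M * (z + 1) → b + M * 1 + M * 0 ≤ M * (z + 1) + 0
  step-stay-rotations M b z h rewrite *-zeroʳ M | +-identityʳ (b + M * 1) | +-identityʳ (M * (z + 1)) = h

  step-enter-reflections : ∀ M b a z → b + M * a ≤ M * (z + 0) → suc b + M * a + M * 1 ≤ M * (z + 1) + suc 0
  step-enter-reflections M b a z h rewrite *-distribˡ-+ M z 1 | *-identityʳ M | +-identityʳ z | +-comm (M * z + M) 1 =
    s≤s (+-monoˡ-≤ M h)

  step-stay-reflections : ∀ M b a z l → b + M * a + M * 1 ≤ M * (z + 1) + l →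
                          suc b + M * a + M * 1 ≤ M * (z + 1) + suc l
  step-stay-reflections M b a z l h rewrite +-suc (M * (z + 1)) l = s≤s h

  startsOutside-≤1 : ∀ xs → startsOutside xs ≤ 1
  startsOutside-≤1 []      = z≤n
  startsOutside-≤1 (x ∷ _) = outside-≤1 (partOf x)
    where
    outside-≤1 : ∀ k → outside k ≤ 1
    outside-≤1 central    = z≤n
    outside-≤1 rotation   = ≤-refl
    outside-≤1 reflection = ≤-refl

  -- The segment count.  Along a commuting path, maximal runs of non-central
  -- vertices lie inside one clique and are separated by central vertices, so
  -- there are at most (#central + [starts outside the centre]) runs; the
  -- rotation run (if any) counts as one run, each reflection run has ≤ m
  -- vertices.  The invariant carries the still-open initial reflection run.
  segment-invariant : ∀ xs → Linked Commute xs → Unique xs →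
    count reflection xs + m * hasRotation xs + m * startsAtReflection xs
      ≤ m * (count central xs + startsOutside xs) + length (leadingReflections xs)

  segment-bound : ∀ xs → Linked Commute xs → Unique xs →
    count reflection xs + m * hasRotation xs ≤ m * (count central xs + startsOutside xs)
  segment-bound xs lk u =
    +-cancelʳ-≤ (m * startsAtReflection xs) _ _
      (≤-trans (segment-invariant xs lk u) (+-monoʳ-≤ _ (leadingReflections-≤ xs lk u)))

  segment-invariant [] _ _ rewrite *-zeroʳ m = z≤n
  segment-invariant (x ∷ xs) lk (_ ∷ u) with partOf x in px
  ... | central = step-central m _ _ _ (startsOutside xs) (startsOutside-≤1 xs) (segment-bound xs (tail lk) u)
    where
    tail : ∀ {y ys} → Linked Commute (y ∷ ys) → Linked Commute ys
    tail [-]     = []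
    tail (_ ∷ l) = l
  segment-invariant (x ∷ []) lk _ | rotation   = step-enter-rotations m 0 0 0 (segment-bound [] [] [])
  segment-invariant (x ∷ []) lk _ | reflection = step-enter-reflections m 0 0 0 (segment-bound [] [] [])
  segment-invariant (x ∷ y ∷ ys) (c ∷ lk) (_ ∷ u) | rotation
    with partOf y in py | segment-bound (y ∷ ys) lk u
  ... | central    | ih = step-enter-rotations m _ _ _ ih
  ... | rotation   | ih = step-stay-rotations m _ _ ih
  ... | reflection | _  = ⊥-elim (rotation-reflection-apart x y px py c)
  segment-invariant (x ∷ y ∷ ys) (c ∷ lk) (_ ∷ u) | reflection
    with partOf y in py | segment-bound (y ∷ ys) lk u | segment-invariant (y ∷ ys) lk u
  ... | central    | ih | _  = step-enter-reflections m _ _ _ ih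
  ... | rotation   | _  | _  = ⊥-elim (rotation-reflection-apart y x py px (sym c))
  ... | reflection | _  | ih = step-stay-reflections m _ _ _ _ ih

  length-parts : ∀ xs → length xs ≡ count central xs + count rotation xs + count reflection xs
  length-parts [] = refl
  length-parts (x ∷ xs) with partOf x
  ... | central    = cong suc (length-parts xs)
  ... | rotation   = trans (cong suc (length-parts xs))
                       (cong (_+ count reflection xs) (sym (+-suc (count central xs) (count rotation xs))))
  ... | reflection = trans (cong suc (length-parts xs))
                       (sym (+-suc (count central xs + count rotation xs) (count reflection xs)))

  hasRotation-01 : ∀ xs → hasRotation xs ≡ 0 ⊎ hasRotation xs ≡ 1
  hasRotation-01 [] = inj₁ refl
  hasRotation-01 (x ∷ xs) with partOf x
  ... | central    = hasRotation-01 xs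
  ... | rotation   = inj₂ refl
  ... | reflection = hasRotation-01 xs

  hasRotation-0 : ∀ xs → hasRotation xs ≡ 0 → count rotation xs ≡ 0
  hasRotation-0 [] _ = refl
  hasRotation-0 (x ∷ xs) h with partOf x
  ... | central    = hasRotation-0 xs h
  ... | reflection = hasRotation-0 xs h
  hasRotation-0 (x ∷ xs) () | rotation

  inPart-⊆ : ∀ k xs {y} → y ∈ inPart k xs → y ∈ xs × partOf y ≡ k
  inPart-⊆ k xs = ∈-filter⁻ (λ x → partOf x ≟ₚ k) {xs = xs}

  inPart-unique : ∀ k xs → Unique xs → Unique (inPart k xs)
  inPart-unique k xs = UP.filter⁺ (λ x → partOf x ≟ₚ k)

  -- A path meets the centre at most m times, the rotations at most n times
  -- and the reflections at most n times.
  count-central-≤ : ∀ xs → Unique xs → count central xs ≤ m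
  count-central-≤ xs u = subst (count central xs ≤_) (length-centreFrom e)
    (unique-length-≤ (inPart central xs) (centreFrom e) (inPart-unique central xs u) in-centre)
    where
    in-centre : ∀ {y} → y ∈ inPart central xs → y ∈ centreFrom e
    in-centre {y} p with central-part y (proj₂ (inPart-⊆ central xs p))
    in-centre {h , .Sign.+} p | refl , h∈Ω = ∈-map⁺ (_, Sign.+) (coset-complete e h (Ω-SameCoset h∈Ω Ω-e))

  count-rotations-≤ : ∀ xs → Unique xs → count central xs + count rotation xs ≤ n
  count-rotations-≤ xs u = subst₂ _≤_ (length-++ (inPart central xs)) (trans (length-map _ (allFin n)) length-allFin)
    (unique-length-≤ (inPart central xs ++ inPart rotation xs) (map (_, Sign.+) (allFin n))
      (UP.++⁺ (inPart-unique central xs u) (inPart-unique rotation xs u) disjoint) is-rotation)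
    where
    disjoint : Disjoint (inPart central xs) (inPart rotation xs)
    disjoint (p , q) with trans (sym (proj₂ (inPart-⊆ central xs p))) (proj₂ (inPart-⊆ rotation xs q))
    ... | ()
    is-rotation : ∀ {y} → y ∈ inPart central xs ++ inPart rotation xs → y ∈ map (_, Sign.+) (allFin n)
    is-rotation {y} p with ∈-++⁻ (inPart central xs) p
    ... | inj₁ q with central-part y (proj₂ (inPart-⊆ central xs q))
    is-rotation {h , .Sign.+} p | inj₁ q | refl , _ = ∈-map⁺ (_, Sign.+) (∈-allFin h)
    is-rotation {y} p | inj₂ q with rotation-part y (proj₂ (inPart-⊆ rotation xs q))
    ... | h , refl , _ = ∈-map⁺ (_, Sign.+) (∈-allFin h)

  count-reflections-≤ : ∀ xs → Unique xs → count reflection xs ≤ n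
  count-reflections-≤ xs u = subst (count reflection xs ≤_) (trans (length-map _ (allFin n)) length-allFin)
    (unique-length-≤ (inPart reflection xs) (map (_, Sign.-) (allFin n)) (inPart-unique reflection xs u) is-reflection)
    where
    is-reflection : ∀ {y} → y ∈ inPart reflection xs → y ∈ map (_, Sign.-) (allFin n)
    is-reflection {y} p with reflection-part y (proj₂ (inPart-⊆ reflection xs p))
    ... | h , refl = ∈-map⁺ (_, Sign.-) (∈-allFin h)

  -- The number of vertices of a longest path starting in a given part.
  maxSize : Part → ℕ
  maxSize central    = (n + n) ⊓ (n + m * m ∸ m)
  maxSize rotation   = (n + n) ⊓ (n + m * m)
  maxSize reflection = (n + n) ⊓ (n + m * m)

  -- Upper bound: a commuting path starting at x has at most maxSize (partOf x) vertices.
  pathLength-bound : m + m ≤ n → ∀ x xs → Linked Commute (x ∷ xs) → Unique (x ∷ xs) →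
                     length (x ∷ xs) ≤ maxSize (partOf x)
  pathLength-bound 2m≤n x xs lk u = subst (_≤ maxSize (partOf x)) (sym (length-parts ys))
    (bound (partOf x) (count-central-≤ ys u) (count-rotations-≤ ys u) (count-reflections-≤ ys u)
      (hasRotation-0 ys) (hasRotation-01 ys) (segment-bound ys lk u))
    where
    ys = x ∷ xs
    z = count central ys
    a = count rotation ys
    b = count reflection ys
    h = hasRotation ys
    bound : ∀ k → z ≤ m → z + a ≤ n → b ≤ n → (h ≡ 0 → a ≡ 0) → (h ≡ 0 ⊎ h ≡ 1) →
            b + m * h ≤ m * (z + outside k) → z + a + b ≤ maxSize k
    bound central    zm zan bn h0 h01 hb = ⊓-glb (+-mono-≤ zan bn) (pathSize-central m n z a b h zm zan 2m≤n h0 h01 hb)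
    bound rotation   zm zan bn h0 h01 hb = ⊓-glb (+-mono-≤ zan bn) (pathSize-outside m n z a b h zm zan 2m≤n h0 h01 hb)
    bound reflection zm zan bn h0 h01 hb = ⊓-glb (+-mono-≤ zan bn) (pathSize-outside m n z a b h zm zan 2m≤n h0 h01 hb)

  -- The non-central rotations, listed as a clique starting with (g,+).
  otherNonΩ? : (g h : Fin n) → Dec (¬ (h ≡ g) × ¬ InΩ h)
  otherNonΩ? g h = ¬? (h F.≟ g) ×-dec ¬? (InΩ? h)

  rotationBlock : Fin n → List D
  rotationBlock g = map (_, Sign.+) (g ∷ filter (otherNonΩ? g) (allFin n))

  rotationBlock-unique : ∀ g → Unique (rotationBlock g)
  rotationBlock-unique g = UP.map⁺ (cong proj₁)
    (All.tabulate (λ p eq → proj₁ (proj₂ (∈-filter⁻ (otherNonΩ? g) {xs = allFin n} p)) (sym eq))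
      ∷ UP.filter⁺ (otherNonΩ? g) (UP.allFin⁺ n))

  -- Together with Ω the block covers G, so it has at least n - m vertices.
  rotationBlock-size : ∀ g → ¬ InΩ g → n ≤ length (rotationBlock g) + m
  rotationBlock-size g g∉Ω = subst₂ _≤_ length-allFin size
    (unique-length-≤ (allFin n) ((g ∷ others) ++ coset e) (UP.allFin⁺ n) covered)
    where
    others = filter (otherNonΩ? g) (allFin n)
    size : length ((g ∷ others) ++ coset e) ≡ length (rotationBlock g) + m
    size = trans (length-++ (g ∷ others)) (cong₂ _+_ (sym (length-map _ (g ∷ others))) (length-coset e))
    covered : ∀ {h} → h ∈ allFin n → h ∈ (g ∷ others) ++ coset e
    covered {h} _ with InΩ? h
    ... | yes h∈Ω = ∈-++⁺ʳ (g ∷ others) (coset-complete e h (Ω-SameCoset h∈Ω Ω-e))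
    ... | no h∉Ω with h F.≟ g
    ...   | yes refl = here refl
    ...   | no h≢g   = there (∈-++⁺ˡ (∈-filter⁺ (otherNonΩ? g) (∈-allFin h) (h≢g , h∉Ω)))

  IsRotation : D → Set
  IsRotation (_ , s) = s ≡ Sign.+

  rotationBlock-rotations : ∀ g → All IsRotation (rotationBlock g)
  rotationBlock-rotations g = All.tabulate λ p → let (_ , _ , eq) = ∈-map⁻ (_, Sign.+) p in cong proj₂ eq

  rotationBlock-noncentral : ∀ g → ¬ InΩ g → All (λ y → ¬ IsCentral y) (rotationBlock g)
  rotationBlock-noncentral g g∉Ω = All.tabulate noncentral
    where
    noncentral : ∀ {y} → y ∈ rotationBlock g → ¬ IsCentral y
    noncentral p central-y with ∈-map⁻ (_, Sign.+) p
    noncentral p (_ , h∈Ω) | .g , here refl , refl = g∉Ω h∈Ω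
    noncentral p (_ , h∈Ω) | h  , there q , refl = proj₂ (proj₂ (∈-filter⁻ (otherNonΩ? g) {xs = allFin n} q)) h∈Ω

  rotationBlock-linked : ∀ g → Linked Commute (rotationBlock g)
  rotationBlock-linked g =
    linked-all {P = IsRotation} (λ { {g , _} {h , _} refl refl → commute-rotations g h }) (rotationBlock-rotations g)

  rotationBlock-reflectionCoset : ∀ a g → Disjoint (rotationBlock a) (reflectionCoset g)
  rotationBlock-reflectionCoset a g (p , q) with All.lookup (rotationBlock-rotations a) p | ∈⇒OverCoset {g} q
  ... | () | _ , refl , _

  -- A transversal of the cosets of Ω, chosen greedily: an element is kept
  -- unless it lies in the coset of an element chosen before.
  NotSameCoset : Fin n → Fin n → Set
  NotSameCoset a b = ¬ SameCoset a b

  pickNew : List (Fin n) → List (Fin n) → List (Fin n)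
  pickNew chosen [] = []
  pickNew chosen (x ∷ xs) with any? (SameCoset? x) chosen
  ... | yes _ = pickNew chosen xs
  ... | no _  = x ∷ pickNew (x ∷ chosen) xs

  pickNew-avoids : ∀ chosen xs → All (λ y → All (NotSameCoset y) chosen) (pickNew chosen xs)
  pickNew-avoids chosen [] = []
  pickNew-avoids chosen (x ∷ xs) with any? (SameCoset? x) chosen
  ... | yes _ = pickNew-avoids chosen xs
  ... | no x-new = ¬Any⇒All¬ chosen x-new ∷ All.map (λ { (_ ∷ r) → r }) (pickNew-avoids (x ∷ chosen) xs)

  pickNew-apart : ∀ chosen xs → AllPairs NotSameCoset (pickNew chosen xs)
  pickNew-apart chosen [] = []
  pickNew-apart chosen (x ∷ xs) with any? (SameCoset? x) chosen
  ... | yes _ = pickNew-apart chosen xs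
  ... | no _  = All.map (λ { (y≁x ∷ _) s → y≁x (SameCoset-sym s) }) (pickNew-avoids (x ∷ chosen) xs)
                ∷ pickNew-apart (x ∷ chosen) xs

  pickNew-covers : ∀ chosen xs {y} → y ∈ xs → Any (SameCoset y) chosen ⊎ Any (SameCoset y) (pickNew chosen xs)
  pickNew-covers chosen (x ∷ xs) p with any? (SameCoset? x) chosen
  pickNew-covers chosen (x ∷ xs) (here refl) | yes old = inj₁ old
  pickNew-covers chosen (x ∷ xs) (there p)   | yes _   = pickNew-covers chosen xs p
  pickNew-covers chosen (x ∷ xs) (here refl) | no _    = inj₂ (here (SameCoset-refl x))
  pickNew-covers chosen (x ∷ xs) (there p)   | no _ with pickNew-covers (x ∷ chosen) xs p
  ... | inj₁ (here s)  = inj₂ (here s)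
  ... | inj₁ (there q) = inj₁ q
  ... | inj₂ q         = inj₂ (there q)

  -- A transversal starting with a given representative g.
  transversal : Fin n → List (Fin n)
  transversal g = g ∷ pickNew (g ∷ []) (allFin n)

  transversal-apart : ∀ g → AllPairs NotSameCoset (transversal g)
  transversal-apart g =
    All.map (λ { (g≁y ∷ []) s → g≁y (SameCoset-sym s) }) (pickNew-avoids (g ∷ []) (allFin n))
      ∷ pickNew-apart (g ∷ []) (allFin n)

  transversal-covers : ∀ g h → Any (SameCoset h) (transversal g)
  transversal-covers g h with pickNew-covers (g ∷ []) (allFin n) (∈-allFin h)
  ... | inj₁ (here s) = here s
  ... | inj₂ q        = there q

  -- The reflection cliques over the cosets of a list of representatives.
  reflectionBlocks : List (Fin n) → List (List D)
  reflectionBlocks = map reflectionCoset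

  reflectionBlocks-unique : ∀ rs → All Unique (reflectionBlocks rs)
  reflectionBlocks-unique rs = AllP.map⁺ (All.universal reflectionCoset-unique rs)

  reflectionBlocks-linked : ∀ rs → All (Linked Commute) (reflectionBlocks rs)
  reflectionBlocks-linked rs = AllP.map⁺ (All.universal reflectionCoset-linked rs)

  reflectionBlocks-noncentral : ∀ rs → All (All (λ y → ¬ IsCentral y)) (reflectionBlocks rs)
  reflectionBlocks-noncentral rs = AllP.map⁺ (All.universal (λ g → All.tabulate λ p → noncentral (∈⇒OverCoset {g} p)) rs)
    where
    noncentral : ∀ {g y} → OverCoset g y → ¬ IsCentral y
    noncentral (_ , refl , _) (() , _)

  reflectionBlocks-disjoint : ∀ {rs} → AllPairs NotSameCoset rs → AllPairs Disjoint (reflectionBlocks rs)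
  reflectionBlocks-disjoint p = APP.map⁺ (AP.map apart p)
    where
    apart : ∀ {a b} → NotSameCoset a b → Disjoint (reflectionCoset a) (reflectionCoset b)
    apart a≁b (p , q) with ∈⇒OverCoset p | ∈⇒OverCoset q
    ... | h , refl , sa | .h , refl , sb = a≁b (SameCoset-trans (SameCoset-sym sa) sb)

  rotationBlock-reflectionBlocks : ∀ a rs → All (Disjoint (rotationBlock a)) (reflectionBlocks rs)
  rotationBlock-reflectionBlocks a rs = AllP.map⁺ (All.universal (rotationBlock-reflectionCoset a) rs)

  totalLength-reflectionBlocks : ∀ j rs → totalLength (take j (reflectionBlocks rs)) ≡ m * (j ⊓ length rs)
  totalLength-reflectionBlocks zero    rs       = sym (*-zeroʳ m)
  totalLength-reflectionBlocks (suc j) []       = sym (*-zeroʳ m)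
  totalLength-reflectionBlocks (suc j) (r ∷ rs) =
    trans (cong₂ _+_ (length-reflectionCoset r) (totalLength-reflectionBlocks j rs)) (sym (*-suc m _))

  totalLength-all : ∀ rs → totalLength (reflectionBlocks rs) ≡ length rs * m
  totalLength-all []       = refl
  totalLength-all (r ∷ rs) = cong₂ _+_ (length-reflectionCoset r) (totalLength-all rs)

  reflections : List D
  reflections = map (_, Sign.-) (allFin n)

  length-reflections : length reflections ≡ n
  length-reflections = trans (length-map _ (allFin n)) length-allFin

  covered-reflection : ∀ {h} rs → Any (SameCoset h) rs → (h , Sign.-) ∈ concat (reflectionBlocks rs)
  covered-reflection (r ∷ rs) (here s)  = ∈-++⁺ˡ (OverCoset⇒∈ (_ , refl , s))
  covered-reflection (r ∷ rs) (there p) = ∈-++⁺ʳ (reflectionCoset r) (covered-reflection rs p)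

  -- The cliques over a transversal partition the n reflections, so the
  -- number of cosets k satisfies k m = n.
  transversal-size : ∀ g → length (transversal g) * m ≡ n
  transversal-size g = ≤-antisym within covers
    where
    rs = transversal g
    size : length (concat (reflectionBlocks rs)) ≡ length rs * m
    size = trans (length-concat (reflectionBlocks rs)) (totalLength-all rs)
    is-reflection : ∀ {y} → y ∈ concat (reflectionBlocks rs) → y ∈ reflections
    is-reflection p with ∈-concat⁻′ (reflectionBlocks rs) p
    ... | b , y∈b , b∈ with ∈-map⁻ reflectionCoset b∈
    ...   | r , _ , refl with ∈⇒OverCoset {r} y∈b
    ...     | h , refl , _ = ∈-map⁺ (_, Sign.-) (∈-allFin h)
    within : length rs * m ≤ n
    within = subst₂ _≤_ size length-reflections
      (unique-length-≤ (concat (reflectionBlocks rs)) reflections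
        (UP.concat⁺ (reflectionBlocks-unique rs) (reflectionBlocks-disjoint (transversal-apart g))) is-reflection)
    covers : n ≤ length rs * m
    covers = subst₂ _≤_ length-reflections size
      (unique-length-≤ reflections (concat (reflectionBlocks rs)) (UP.map⁺ (cong proj₁) (UP.allFin⁺ n))
        (λ p → let (h , _ , eq) = ∈-map⁻ (_, Sign.-) p in
               subst (_∈ concat (reflectionBlocks rs)) (sym eq) (covered-reflection rs (transversal-covers g h))))

  -- Blocks from which long paths are woven: commuting cliques of non-central
  -- vertices, each without repetition and pairwise disjoint.
  record Blocks (bs : List (List D)) : Set where
    field
      linked     : All (Linked Commute) bs
      unique     : All Unique bs
      disjoint   : AllPairs Disjoint bs
      noncentral : All (All (λ y → ¬ IsCentral y)) bs

  -- The rotation block followed by the reflection cliques over distinct cosets.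
  rotations-then-reflections : ∀ a → ¬ InΩ a → ∀ {rs} → AllPairs NotSameCoset rs →
                               Blocks (rotationBlock a ∷ reflectionBlocks rs)
  rotations-then-reflections a a∉Ω {rs} apart = record
    { linked     = rotationBlock-linked a ∷ reflectionBlocks-linked rs
    ; unique     = rotationBlock-unique a ∷ reflectionBlocks-unique rs
    ; disjoint   = rotationBlock-reflectionBlocks a rs ∷ reflectionBlocks-disjoint apart
    ; noncentral = rotationBlock-noncentral a a∉Ω ∷ reflectionBlocks-noncentral rs
    }

  -- The same with a further reflection clique, over a new coset, in front.
  reflections-first : ∀ a → ¬ InΩ a → ∀ g {rs} → AllPairs NotSameCoset (g ∷ rs) →
                      Blocks (reflectionCoset g ∷ rotationBlock a ∷ reflectionBlocks rs)
  reflections-first a a∉Ω g {rs} apart = record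
    { linked     = reflectionCoset-linked g ∷ Blocks.linked rest
    ; unique     = reflectionCoset-unique g ∷ Blocks.unique rest
    ; disjoint   = (flip (rotationBlock-reflectionCoset a g) ∷ AP.head (reflectionBlocks-disjoint apart))
                   ∷ Blocks.disjoint rest
    ; noncentral = All.head (reflectionBlocks-noncentral (g ∷ rs)) ∷ Blocks.noncentral rest
    }
    where
    rest = rotations-then-reflections a a∉Ω (AP.tail apart)
    flip : ∀ {xs ys : List D} → Disjoint xs ys → Disjoint ys xs
    flip d (p , q) = d (q , p)

  -- Weaving blocks through distinct central vertices gives a commuting path.
  woven-path : ∀ {bs zs} → Blocks bs → Unique zs → All IsCentral zs →
               Linked Commute (weave bs zs) × Unique (weave bs zs)
  woven-path {bs} {zs} B uz cz =
    linked-weave bs zs (Blocks.linked B) (All.map central-universal cz) ,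
    unique-weave bs zs (Blocks.unique B) (Blocks.disjoint B) uz
      (λ { (p , q) → All.lookup (AllP.concat⁺ (Blocks.noncentral B)) p (All.lookup cz q) })

  -- A commuting path from v of the maximal possible size.
  LongPath : D → Set
  LongPath v = Σ (List D) λ xs →
    Linked Commute (v ∷ xs) × Unique (v ∷ xs) × maxSize (partOf v) ≤ length (v ∷ xs)

  StartsAt : D → List D → Set
  StartsAt v []      = ⊥
  StartsAt v (x ∷ _) = x ≡ v

  toLongPath : ∀ {v} P → StartsAt v P → Linked Commute P × Unique P →
               maxSize (partOf v) ≤ length P → LongPath v
  toLongPath (x ∷ xs) refl (lk , u) size = xs , lk , u , size

  -- From a reflection (g,-): its clique, then the rotation block, then the
  -- other reflection cliques, separated by the m central vertices.
  longPath-reflection : ∀ a → ¬ InΩ a → ∀ g → LongPath (g , Sign.-)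
  longPath-reflection a a∉Ω g = toLongPath P refl path
    (subst (maxSize reflection ≤_) (sym size)
      (weaveSize-reflection p m n (length (rotationBlock a)) (length rest) (sym (length-centreFrom e))
        (rotationBlock-size a a∉Ω) (≤-reflexive (sym (transversal-size g)))))
    where
    rest = pickNew (g ∷ []) (allFin n)
    bs = reflectionCoset g ∷ rotationBlock a ∷ reflectionBlocks rest
    P = weave bs (centreFrom e)
    path = woven-path (reflections-first a a∉Ω g (transversal-apart g))
             (centreFrom-unique e) (centreFrom-central e Ω-e)
    p = length (map (_, Sign.+) (map (e ·_) Ω∖e))
    size : length P ≡ m + (length (rotationBlock a) + m * (p ⊓ length rest)) + suc p
    size = trans (length-weave bs (centreFrom e))
      (cong (_+ suc p) (cong₂ _+_ (length-reflectionCoset g)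
        (cong (length (rotationBlock a) +_) (totalLength-reflectionBlocks p rest))))

  -- From a non-central rotation (g,+): its block, then the reflection cliques.
  longPath-rotation : ∀ g → ¬ InΩ g → LongPath (g , Sign.+)
  longPath-rotation g g∉Ω = toLongPath P refl path
    (subst (_≤ length P) (cong maxSize (sym (partOf-rotation g∉Ω)))
      (subst (maxSize rotation ≤_) (sym size)
        (weaveSize-rotation p m n (length (rotationBlock g)) (length (transversal e)) (sym (length-centreFrom e))
          (rotationBlock-size g g∉Ω) (≤-reflexive (sym (transversal-size e))))))
    where
    bs = rotationBlock g ∷ reflectionBlocks (transversal e)
    P = weave bs (centreFrom e)
    path = woven-path (rotations-then-reflections g g∉Ω (transversal-apart e))
             (centreFrom-unique e) (centreFrom-central e Ω-e)
    p = length (map (_, Sign.+) (map (e ·_) Ω∖e))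
    size : length P ≡ length (rotationBlock g) + m * (suc p ⊓ length (transversal e)) + suc p
    size = trans (length-weave bs (centreFrom e))
      (cong (λ t → length (rotationBlock g) + t + suc p) (totalLength-reflectionBlocks (suc p) (transversal e)))

  -- From a central vertex (g,+): the same weave, through the other m - 1
  -- central vertices, after (g,+) itself.
  longPath-central : ∀ a → ¬ InΩ a → ∀ g → InΩ g → LongPath (g , Sign.+)
  longPath-central a a∉Ω g g∈Ω = toLongPath P refl (linked , unique)
    (subst (_≤ length P) (cong maxSize (sym (partOf-central g∈Ω)))
      (subst (maxSize central ≤_) (sym size)
        (weaveSize-central p m n (length (rotationBlock a)) (length (transversal e)) (sym (length-centreFrom g))
          (rotationBlock-size a a∉Ω) (≤-reflexive (sym (transversal-size e))))))
    where
    B = rotations-then-reflections a a∉Ω (transversal-apart e)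
    bs = rotationBlock a ∷ reflectionBlocks (transversal e)
    zs = map (_, Sign.+) (map (g ·_) Ω∖e)
    w = weave bs zs
    P = (g , Sign.+) ∷ w
    centre-unique = centreFrom-unique g
    centre-central = centreFrom-central g g∈Ω
    path = woven-path B (AP.tail centre-unique) (All.tail centre-central)
    linked : Linked Commute P
    linked = linked-join [] (central-universal (All.head centre-central)) [] (proj₁ path)
    g∉w : ∀ {y} → y ∈ w → (g , Sign.+) ≢ y
    g∉w q eq with ∈-weave⁻ bs zs q
    ... | inj₁ r = All.lookup (AllP.concat⁺ (Blocks.noncentral B)) r (subst IsCentral eq (All.head centre-central))
    ... | inj₂ r = All.lookup (AP.head centre-unique) r eq
    unique : Unique P
    unique = All.tabulate g∉w ∷ proj₂ path
    p = length zs
    size : length P ≡ suc (length (rotationBlock a) + m * (p ⊓ length (transversal e)) + p)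
    size = cong suc (trans (length-weave bs zs)
      (cong (λ t → length (rotationBlock a) + t + p) (totalLength-reflectionBlocks p (transversal e))))

  longPath : ∀ a → ¬ InΩ a → ∀ v → LongPath v
  longPath a a∉Ω (g , Sign.-) = longPath-reflection a a∉Ω g
  longPath a a∉Ω (g , Sign.+) = byMembership (InΩ? g)
    where
    byMembership : Dec (InΩ g) → LongPath (g , Sign.+)
    byMembership (yes g∈Ω) = longPath-central a a∉Ω g g∈Ω
    byMembership (no g∉Ω)  = longPath-rotation g g∉Ω

  open Graph CommAdj

  -- With a ∉ Ω at hand (so 2m ≤ n), the detour eccentricity of v is
  -- maxSize (partOf v) - 1.
  module Eccentricities (a : Fin n) (a∉Ω : ¬ InΩ a) where

    path-bound : ∀ v {ys w} → IsPath v w ys → length ys ≤ maxSize (partOf v)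
    path-bound v (single _ , u)                = pathLength-bound (m+m≤n a a∉Ω) v [] [-] u
    path-bound v (ch@(step {ys = ys} _ _) , u) = pathLength-bound (m+m≤n a a∉Ω) v (_ ∷ ys) (chain⇒linked ch) u

    eccentricity : ∀ v → IsDetourEcc v (maxSize (partOf v) ∸ 1)
    eccentricity v = subst (IsDetourEcc v) (cong (_∸ 1) size≡) ((lastOf v xs , distance) , bound)
      where
      long = longPath a a∉Ω v
      xs = proj₁ long
      lk = proj₁ (proj₂ long)
      u = proj₁ (proj₂ (proj₂ long))
      reaches = proj₂ (proj₂ (proj₂ long))
      size≡ : suc (length xs) ≡ maxSize (partOf v)
      size≡ = ≤-antisym (pathLength-bound (m+m≤n a a∉Ω) v xs lk u) reaches
      distance : IsDetourDist v (lastOf v xs) (length xs)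
      distance = (v ∷ xs , (linked⇒chain v xs lk u , u) , refl) ,
                 λ ys p → ≤-trans (path-bound v p) reaches
      bound : ∀ w d → IsDetourDist v w d → d ≤ length xs
      bound w d ((ys , p , len) , _) = s≤s⁻¹ (≤-trans (≤-reflexive (sym len)) (≤-trans (path-bound v p) reaches))

    eccentricity-unique : ∀ v ε → IsDetourEcc v ε → ε ≡ maxSize (partOf v) ∸ 1
    eccentricity-unique v ε ((w , (ys , p , len) , _) , maximal) =
      ≤-antisym (∸-monoˡ-≤ 1 (≤-trans (≤-reflexive (sym len)) (path-bound v p)))
                (maximal _ _ (proj₂ (proj₁ (eccentricity v))))

    central-minimal : ∀ k → maxSize central ≤ maxSize k
    central-minimal central    = ≤-refl
    central-minimal rotation   = ⊓-monoʳ-≤ (n + n) (m∸n≤m (n + m * m) m)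
    central-minimal reflection = ⊓-monoʳ-≤ (n + n) (m∸n≤m (n + m * m) m)

    reflection-maximal : ∀ k → maxSize k ≤ maxSize reflection
    reflection-maximal central    = ⊓-monoʳ-≤ (n + n) (m∸n≤m (n + m * m) m)
    reflection-maximal rotation   = ≤-refl
    reflection-maximal reflection = ≤-refl

    -- The radius is attained at the identity (a central vertex) ...
    radius : IsDetourRadius (maxSize central ∸ 1)
    radius = ((e , Sign.+) , subst (λ k → IsDetourEcc (e , Sign.+) (maxSize k ∸ 1)) (partOf-central Ω-e)
                                   (eccentricity (e , Sign.+))) ,
             λ v ε ecc → subst (maxSize central ∸ 1 ≤_) (sym (eccentricity-unique v ε ecc))
                               (∸-monoˡ-≤ 1 (central-minimal (partOf v)))

    -- ... and the diameter at a reflection.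
    diameter : IsDetourDiameter (maxSize reflection ∸ 1)
    diameter = ((e , Sign.-) , eccentricity (e , Sign.-)) ,
               λ v ε ecc → subst (_≤ maxSize reflection ∸ 1) (sym (eccentricity-unique v ε ecc))
                                 (∸-monoˡ-≤ 1 (reflection-maximal (partOf v)))

  -- Evaluating the minima defining maxSize.
  1≤m : 1 ≤ m
  1≤m = subst (1 ≤_) (length-coset e) (s≤s z≤n)

  m≤m*m : m ≤ m * m
  m≤m*m = subst (_≤ m * m) (*-identityʳ m) (*-monoʳ-≤ m 1≤m)

  2*n≡n+n : 2 * n ≡ n + n
  2*n≡n+n = cong (n +_) (+-identityʳ n)

  -- If n < m², then n/m < m, hence n + m ≤ m² and the minimum is 2n.
  radius-small : n < m * m → maxSize central ∸ 1 ≡ 2 * n ∸ 1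
  radius-small n<m² = cong (_∸ 1) (trans (m≤n⇒m⊓n≡m 2n≤) (sym 2*n≡n+n))
    where
    k = length (transversal e)
    k<m : k < m
    k<m = *-cancelʳ-< m k m (subst (_< m * m) (sym (transversal-size e)) n<m²)
    n+m≤m² : n + m ≤ m * m
    n+m≤m² = subst (_≤ m * m) (trans (+-comm m (k * m)) (cong (_+ m) (transversal-size e))) (*-monoˡ-≤ m k<m)
    2n≤ : n + n ≤ n + m * m ∸ m
    2n≤ = ≤-trans (+-monoʳ-≤ n (m+n≤o⇒m≤o∸n n n+m≤m²)) (≤-reflexive (sym (+-∸-assoc n m≤m*m)))

  radius-large : m * m ≤ n → maxSize central ∸ 1 ≡ n + m * (m ∸ 1) ∸ 1
  radius-large m²≤n = cong (_∸ 1) (trans (m≥n⇒m⊓n≡n ≤2n) value)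
    where
    value : n + m * m ∸ m ≡ n + m * (m ∸ 1)
    value = trans (+-∸-assoc n m≤m*m)
                  (cong (n +_) (sym (trans (*-distribˡ-∸ m m 1) (cong (m * m ∸_) (*-identityʳ m)))))
    ≤2n : n + m * m ∸ m ≤ n + n
    ≤2n = ≤-trans (∸-monoˡ-≤ m (+-monoʳ-≤ n m²≤n)) (m∸n≤m (n + n) m)

  diameter-small : n ≤ m * m → maxSize reflection ∸ 1 ≡ 2 * n ∸ 1
  diameter-small n≤m² = cong (_∸ 1) (trans (m≤n⇒m⊓n≡m (+-monoʳ-≤ n n≤m²)) (sym 2*n≡n+n))

  diameter-large : m * m < n → maxSize reflection ∸ 1 ≡ n + m * m ∸ 1
  diameter-large m²<n = cong (_∸ 1) (m≥n⇒m⊓n≡n (+-monoʳ-≤ n (<⇒≤ m²<n)))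

corollary3p2 : (n : ℕ) (_·_ : Op₂ (Fin n)) (e : Fin n) (inv : Op₁ (Fin n)) →
    IsAbelianGroup _≡_ _·_ e inv →
    Dihedral.NonAbelianD _·_ e inv →
    (r : ℕ) → 2 ^ r ≡ Dihedral.involutionCount _·_ e inv →
    ((n < 2 ^ r * 2 ^ r → Graph.IsDetourRadius (Dihedral.CommAdj _·_ e inv) (2 * n ∸ 1)) ×
     (2 ^ r * 2 ^ r ≤ n → Graph.IsDetourRadius (Dihedral.CommAdj _·_ e inv) (n + 2 ^ r * (2 ^ r ∸ 1) ∸ 1))) ×
    ((n ≤ 2 ^ r * 2 ^ r → Graph.IsDetourDiameter (Dihedral.CommAdj _·_ e inv) (2 * n ∸ 1)) ×
     (2 ^ r * 2 ^ r < n → Graph.IsDetourDiameter (Dihedral.CommAdj _·_ e inv) (n + 4 ^ r ∸ 1)))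
corollary3p2 n _·_ e inv G nonAbelian r 2^r≡m rewrite 4^r≡2^r*2^r r | 2^r≡m =
  ( (λ n<m² → subst IsDetourRadius (radius-small n<m²) radius)
  , (λ m²≤n → subst IsDetourRadius (radius-large m²≤n) radius) )
  , ( (λ n≤m² → subst IsDetourDiameter (diameter-small n≤m²) diameter)
    , (λ m²<n → subst IsDetourDiameter (diameter-large m²<n) diameter) )
  where
  open Graph (Dihedral.CommAdj _·_ e inv) using (IsDetourRadius; IsDetourDiameter)
  open CommutingGraph n _·_ e inv G
  open Eccentricities (proj₁ (nonAbelian⇒notΩ nonAbelian)) (proj₂ (nonAbelian⇒notΩ nonAbelian))
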